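{- Let $H$ be a fixed graph such that $H$ is not an induced subgraph of $P_4$ and $H \notin \{3P_1,\ P_3+P_1,\ P_2+2P_1\}$. Then any streaming algorithm for \textsc{Diameter} in the AL model that uses $p$ passes over the stream must use $\Omega(n/p)$ bits of memory on $n$-vertex graphs $G$, even when $G$ is $H$-free.
   Context: Graphs are finite, simple, undirected, unweighted. $P_a$ is the path on $a$ vertices; $G_1+G_2$ is the disjoint union, and $sG$ is the disjoint union of $s$ copies of $G$. $G$ is $H$-free if it has no induced subgraph isomorphic to $H$. \textsc{Diameter}: compute $\max_{s,t} d(s,t)$ (shortest-path distance). In the Adjacency List (AL) streaming model the graph arrives as a sequence of vertices in arbitrary fixed order, each together with the full list of its incident edges (each edge appears twice). A $p$-pass algorithm reads the sequence $p$ times with unlimited computation; memory is measured in bits. "Must use $\Omega(f)$ bits" means there is a constant $c>0$ (depending on $H$) such that every $p$-pass algorithm solving the problem correctly on all inputs of the stated class uses at least $c\cdot f$ bits of memory on some $n$-vertex input, for all sufficiently large $n$ and all $p$. -}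

module Defs where

open import Data.Nat using (ℕ; zero; suc; _+_; _*_; _^_; _≤_)
open import Data.Nat.Properties using (1+n≢n)
open import Data.Bool using (Bool; true; false; _∨_)
open import Data.Bool.Properties using (∨-comm)
open import Data.Fin using (Fin; toℕ; splitAt)
open import Data.Fin.Permutation using (Permutation′; _⟨$⟩ʳ_)
open import Data.List using (List; map; foldl)
open import Data.List using () renaming (allFin to allFinL)
open import Data.Maybe using (Maybe; just; nothing)
open import Data.Product using (Σ; ∃; ∃-syntax; _×_; _,_)
open import Data.Sum using (_⊎_; inj₁; inj₂)
open import Relation.Binary.PropositionalEquality using (_≡_; refl; sym)
open import Relation.Nullary using (¬_; yes; no)
open import Data.Empty using (⊥-elim)
open import Relation.Nullary.Decidable using (⌊_⌋; dec-false)
import Data.Nat as ℕ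

record Graph (n : ℕ) : Set where
  field
    adj     : Fin n → Fin n → Bool
    adj-sym : ∀ i j → adj i j ≡ adj j i
    irrefl  : ∀ i → adj i i ≡ false
open Graph public

InducedSub : ∀ {k n} → Graph k → Graph n → Set
InducedSub {k} {n} H G =
  Σ (Fin k → Fin n) λ f →
    (∀ i j → f i ≡ f j → i ≡ j) × (∀ i j → adj G (f i) (f j) ≡ adj H i j)

Free : ∀ {k n} → Graph k → Graph n → Set
Free H G = ¬ InducedSub H G

Iso : ∀ {k l} → Graph k → Graph l → Set
Iso {k} {l} G G' =
  Σ (Fin k → Fin l) λ f → Σ (Fin l → Fin k) λ g →
    (∀ i → g (f i) ≡ i) × (∀ j → f (g j) ≡ j) ×
    (∀ i j → adj G' (f i) (f j) ≡ adj G i j)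

pathAdj : ∀ {a} → Fin a → Fin a → Bool
pathAdj i j = ⌊ suc (toℕ i) ℕ.≟ toℕ j ⌋ ∨ ⌊ suc (toℕ j) ℕ.≟ toℕ i ⌋

P : (a : ℕ) → Graph a
P a = record
  { adj = pathAdj
  ; adj-sym = λ i j → ∨-comm ⌊ suc (toℕ i) ℕ.≟ toℕ j ⌋ ⌊ suc (toℕ j) ℕ.≟ toℕ i ⌋
  ; irrefl = λ i → irr (toℕ i)
  }
  where
  irr : ∀ x → (⌊ suc x ℕ.≟ x ⌋ ∨ ⌊ suc x ℕ.≟ x ⌋) ≡ false
  irr x with suc x ℕ.≟ x
  ... | yes e = ⊥-elim (1+n≢n e)
  ... | no _ = refl

module _ {a b : ℕ} (G₁ : Graph a) (G₂ : Graph b) where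
  adj⊎ : Fin a ⊎ Fin b → Fin a ⊎ Fin b → Bool
  adj⊎ (inj₁ x) (inj₁ y) = adj G₁ x y
  adj⊎ (inj₁ x) (inj₂ y) = false
  adj⊎ (inj₂ x) (inj₁ y) = false
  adj⊎ (inj₂ x) (inj₂ y) = adj G₂ x y

  adj⊎-sym : ∀ u v → adj⊎ u v ≡ adj⊎ v u
  adj⊎-sym (inj₁ x) (inj₁ y) = adj-sym G₁ x y
  adj⊎-sym (inj₁ x) (inj₂ y) = refl
  adj⊎-sym (inj₂ x) (inj₁ y) = refl
  adj⊎-sym (inj₂ x) (inj₂ y) = adj-sym G₂ x y

  adj⊎-irr : ∀ u → adj⊎ u u ≡ false
  adj⊎-irr (inj₁ x) = irrefl G₁ x
  adj⊎-irr (inj₂ x) = irrefl G₂ x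

_⊕_ : ∀ {a b} → Graph a → Graph b → Graph (a + b)
_⊕_ {a} G₁ G₂ = record
  { adj = λ i j → adj⊎ G₁ G₂ (splitAt a i) (splitAt a j)
  ; adj-sym = λ i j → adj⊎-sym G₁ G₂ (splitAt a i) (splitAt a j)
  ; irrefl = λ i → adj⊎-irr G₁ G₂ (splitAt a i)
  }
infixr 5 _⊕_

3P₁ : Graph 3
3P₁ = P 1 ⊕ P 1 ⊕ P 1

P₃+P₁ : Graph 4
P₃+P₁ = P 3 ⊕ P 1

P₂+2P₁ : Graph 4
P₂+2P₁ = P 2 ⊕ P 1 ⊕ P 1

data Reach {n : ℕ} (G : Graph n) : ℕ → Fin n → Fin n → Set where
  here : ∀ {k s} → Reach G k s s
  step : ∀ {k s u t} → adj G s u ≡ true → Reach G k u t → Reach G (suc k) s t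

-- IsDiameter G (just d) : max_{s,t} d(s,t) = d
-- IsDiameter G nothing  : some pair is at infinite distance (diameter ∞)
IsDiameter : ∀ {n} → Graph n → Maybe ℕ → Set
IsDiameter {n} G (just d) =
  (∀ s t → Reach G d s t) × (∀ d' → (∀ s t → Reach G d' s t) → d ≤ d')
IsDiameter {n} G nothing = ∃[ s ] ∃[ t ] (∀ k → ¬ Reach G k s t)

-- A stream item: a vertex together with its full neighbourhood.
Item : ℕ → Set
Item n = Fin n × (Fin n → Bool)

item : ∀ {n} → Graph n → Fin n → Item n
item G v = v , adj G v

stream : ∀ {n} → Graph n → Permutation′ n → List (Item n)
stream G σ = map (λ i → item G (σ ⟨$⟩ʳ i)) (allFinL _)

-- A deterministic p-pass algorithm with m bits of memory on n-vertex
-- inputs: its memory state is one of 2^m values; between items it may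
-- perform unlimited computation.  The transition may depend on the pass.
record Alg (n p m : ℕ) : Set where
  field
    init   : Fin (2 ^ m)
    trans  : Fin p → Fin (2 ^ m) → Item n → Fin (2 ^ m)
    output : Fin (2 ^ m) → Maybe ℕ
open Alg public

runPasses : ∀ {n} {S : Set} → (p : ℕ) → (Fin p → S → Item n → S) →
            List (Item n) → S → S
runPasses zero    tr xs s = s
runPasses (suc p) tr xs s =
  runPasses p (λ i → tr (Fin.suc i)) xs (foldl (tr Fin.zero) s xs)
  where import Data.Fin as Fin

run : ∀ {n p m} → Alg n p m → List (Item n) → Maybe ℕ
run {p = p} A xs = output A (runPasses p (trans A) xs (init A))

SolvesDiameterFree : ∀ {k n p m} → Graph k → Alg n p m → Set
SolvesDiameterFree {n = n} H A =
  (G : Graph n) → Free H G → (σ : Permutation′ n) → IsDiameter G (run A (stream G σ))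

{-# OPTIONS --safe #-}
module Submission where

-- Fooling sets.  A p-pass algorithm with m bits, run on a stream whose first part belongs to
-- Alice and second part to Bob, is determined by p pairs of memory states.  If 2^N > 2^(2pm), two
-- inputs x ≠ x′ in {0,1}^N share these states, so the algorithm answers alike on the graphs
-- G(x,x), G(x′,x′), G(x,x′) and G(x′,x).  In a hard family all distances in G(x,x) are at most D,
-- but some distance in G(x,y) exceeds D as soon as x i = 0 and y i = 1 for some i, a contradiction;
-- hence N ≤ 2pm.
--
-- A graph H outside the exceptions contains an induced C₃, C₄, C₅, claw, 2P₂, 4P₁ or P₄+P₁: this
-- is decided by inspecting all graphs on at most five vertices, since no graph on five vertices
-- avoids all seven.  It then suffices to have hard families avoiding each of the seven: trees avoid
-- cycles, trees with adjacent siblings avoid claws, split graphs avoid 2P₂, and certain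
-- graphs covered by three cliques avoid 4P₁ and P₄+P₁.

open import Defs
open import Data.Bool using (Bool; true; false; T; not; if_then_else_; _∧_; _∨_; _xor_)
open import Data.Bool.ListAction using (any)
import Data.Bool.Properties as Bool
open import Data.Bool.Properties using (∨-comm; xor-comm; xor-same; T-≡; T-∧; T-∨; T?)
open import Data.Empty using (⊥)
open import Data.Fin
  using (Fin; zero; suc; toℕ; _↑ˡ_; _↑ʳ_; splitAt; punchOut; combine; finToFun; funToFin)
import Data.Fin as Fin
open import Data.Fin.Patterns
open import Data.Fin.Permutation using (id)
import Data.Fin.Properties as Fin
open import Data.List using (List; []; _∷_; _++_; map; foldl; tabulate; allFin)
open import Data.List.Properties using (foldl-++; map-tabulate; tabulate-cong)
open import Data.List.Relation.Unary.All as All using (All; []; _∷_)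
open import Data.List.Relation.Unary.Any as Any using (Any)
open import Data.List.Relation.Unary.Any.Properties using (any⁻)
open import Data.Maybe using (just; nothing)
open import Data.Nat
  using (ℕ; zero; suc; _+_; _*_; _∸_; _/_; _%_; _^_; _≡ᵇ_; _≤_; _<_; z≤n; s≤s; NonZero)
import Data.Nat as ℕ
open import Data.Nat.DivMod using (m≡m%n+[m/n]*n; m%n<n; m≥n⇒m/n>0)
import Data.Nat.Properties as ℕ
open import Data.Nat.Tactic.RingSolver using (solve-∀)
open import Data.Product using (Σ; ∃; ∃₂; ∃-syntax; _×_; _,_; proj₁; proj₂)
open import Data.Product.Properties using (,-injectiveˡ; ,-injectiveʳ)
open import Data.Sum as Sum using (_⊎_; inj₁; inj₂; [_,_]′)
open import Data.Sum.Function.Propositional using (_⊎-↔_)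
open import Data.Sum.Properties using (≡-dec)
open import Data.Vec using (Vec; []; _∷_; lookup)
import Data.Vec as Vec
open import Data.Vec.Properties using (∷-injective; lookup∘tabulate)
open import Function using (_∘_; _↔_; Inverse; Injection; Equivalence; mk⇔)
open import Function.Construct.Composition using (_↔-∘_)
open import Function.Construct.Identity using (↔-id)
open import Function.Properties.Inverse using (↔⇒↣)
open import Relation.Binary using (tri<; tri≈; tri>)
open import Relation.Binary.PropositionalEquality
  using (_≡_; _≢_; refl; sym; cong; cong₂; subst; module ≡-Reasoning) renaming (trans to ≡-trans)
open import Relation.Nullary using (¬_; Dec; yes; no; contradiction)
open import Relation.Nullary.Decidable
  using (⌊_⌋; does; does-⇔; dec-true; dec-false; ¬?; _×-dec_; _⊎-dec_; _→-dec_; from-yes)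

-- Unavoidable induced subgraphs

Table : ℕ → Set
Table n = Fin n → Fin n → Bool

InducedSub-trans : ∀ {a b c} {F : Graph a} {G : Graph b} {H : Graph c} →
                   InducedSub F G → InducedSub G H → InducedSub F H
InducedSub-trans (f , f-inj , f-adj) (g , g-inj , g-adj) =
  g ∘ f , (λ i j → f-inj i j ∘ g-inj _ _) , λ i j → ≡-trans (g-adj _ _) (f-adj i j)

_==_ : Bool → Bool → Bool
a == b = not (a xor b)

T-== : ∀ {a b} → T (a == b) → a ≡ b
T-== {true}  {true}  _ = refl
T-== {false} {false} _ = refl

-- Forward checking: once vertex `0` sits at `v`, unsuitable images of all later vertices are
-- discarded at once, which keeps the exhaustive evaluations small.
narrow : ∀ {k n} → Table (suc k) → Table n → (Fin (suc k) → Fin n → Bool) →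
         Fin n → Fin k → Fin n → Bool
narrow F t c v i w = c (suc i) w ∧ (not ⌊ v Fin.≟ w ⌋ ∧ (t v w == F zero (suc i)))

-- Backtracking search: c i v says that v is still a possible image of i.
embeds : ∀ {k n} → Table k → Table n → (Fin k → Fin n → Bool) → Bool
embeds {zero}      F t c = true
embeds {suc k} {n} F t c =
  any (λ v → c zero v ∧ embeds (λ i j → F (suc i) (suc j)) t (narrow F t c v)) (allFin n)

∧⁻ : ∀ a {b} → T (a ∧ b) → T a × T b
∧⁻ a = Equivalence.to (T-∧ {a})

-- Each vertex is compared only with those placed after it, hence the restriction to `i < j`;
-- symmetry and irreflexivity supply the rest in `⊑ᵇ-sound`.
embeds-sound : ∀ {k n} (F : Table k) (t : Table n) c → T (embeds F t c) →
  Σ (Fin k → Fin n) λ f → (∀ i → T (c i (f i))) ×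
    (∀ i j → i Fin.< j → f i ≢ f j × t (f i) (f j) ≡ F i j)
embeds-sound {zero}      F t c _ = (λ ()) , (λ ()) , λ ()
embeds-sound {suc k} {n} F t c p
  with v , q ← Any.satisfied (any⁻ _ (allFin n) p)
  with cv , r ← ∧⁻ (c zero v) q
  with f , ok , emb ← embeds-sound _ t (narrow F t c v) r
  = f′ , ok′ , emb′
  where
  f′ : Fin (suc k) → Fin n
  f′ zero    = v
  f′ (suc i) = f i

  constraint : ∀ i → T (not ⌊ v Fin.≟ f i ⌋) × T (t v (f i) == F zero (suc i))
  constraint i = ∧⁻ (not ⌊ v Fin.≟ f i ⌋) (proj₂ (∧⁻ (c (suc i) (f i)) (ok i)))

  apart : ∀ {w} → T (not ⌊ v Fin.≟ w ⌋) → v ≢ w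
  apart {w} x with no v≢w ← v Fin.≟ w = v≢w

  ok′ : ∀ i → T (c i (f′ i))
  ok′ zero    = cv
  ok′ (suc i) = proj₁ (∧⁻ (c (suc i) (f i)) (ok i))

  emb′ : ∀ i j → i Fin.< j → f′ i ≢ f′ j × t (f′ i) (f′ j) ≡ F i j
  emb′ zero    (suc j) _           = apart (proj₁ (constraint j)) , T-== (proj₂ (constraint j))
  emb′ (suc i) (suc j) (ℕ.s≤s i<j) = emb i j i<j

_⊑ᵇ_ : ∀ {k n} → Table k → Table n → Bool
F ⊑ᵇ t = embeds F t (λ _ _ → true)

⊑ᵇ-sound : ∀ {k n} (F : Graph k) (G : Graph n) {s : Table k} {t : Table n} →
           (∀ i j → s i j ≡ adj F i j) → (∀ i j → t i j ≡ adj G i j) →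
           T (s ⊑ᵇ t) → InducedSub F G
⊑ᵇ-sound F G {s} {t} s≗F t≗G p with f , _ , emb ← embeds-sound s t _ p = f , inj , pres
  where
  inj : ∀ i j → f i ≡ f j → i ≡ j
  inj i j eq with Fin.<-cmp i j
  ... | tri< i<j _ _ = contradiction eq (proj₁ (emb i j i<j))
  ... | tri≈ _ i≡j _ = i≡j
  ... | tri> _ _ j<i = contradiction (sym eq) (proj₁ (emb j i j<i))

  pres< : ∀ i j → i Fin.< j → adj G (f i) (f j) ≡ adj F i j
  pres< i j i<j = ≡-trans (sym (t≗G _ _)) (≡-trans (proj₂ (emb i j i<j)) (s≗F i j))

  pres : ∀ i j → adj G (f i) (f j) ≡ adj F i j
  pres i j with Fin.<-cmp i j
  ... | tri< i<j _ _  = pres< i j i<j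
  ... | tri≈ _ refl _ = ≡-trans (irrefl G _) (sym (irrefl F _))
  ... | tri> _ _ j<i  = ≡-trans (adj-sym G _ _) (≡-trans (pres< j i j<i) (adj-sym F _ _))

allRows : ∀ n → (Vec Bool n → Bool) → Bool
allRows zero    p = p []
allRows (suc n) p = allRows n (λ r → p (true ∷ r)) ∧ allRows n (λ r → p (false ∷ r))

allRows-sound : ∀ {n} p → T (allRows n p) → ∀ r → T (p r)
allRows-sound         p h []          = h
allRows-sound {suc n} p h (true  ∷ r) = allRows-sound _ (proj₁ (∧⁻ (allRows n _) h)) r
allRows-sound {suc n} p h (false ∷ r) = allRows-sound _ (proj₂ (∧⁻ (allRows n _) h)) r

addVertex : ∀ {n} → Vec Bool n → Table n → Table (suc n)
addVertex r t zero    zero    = false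
addVertex r t zero    (suc j) = lookup r j
addVertex r t (suc i) zero    = lookup r i
addVertex r t (suc i) (suc j) = t i j

allTables : ∀ n → (Table n → Bool) → Bool
allTables zero    p = p (λ ())
allTables (suc n) p = allTables n (λ t → allRows n (λ r → p (addVertex r t)))

deleteZero : ∀ {n} → Graph (suc n) → Graph n
deleteZero G = record
  { adj     = λ i j → adj G (suc i) (suc j)
  ; adj-sym = λ i j → adj-sym G (suc i) (suc j)
  ; irrefl  = λ i → irrefl G (suc i)
  }

-- Functions are compared only pointwise, so the enumeration reaches a table that agrees with
-- `adj G` rather than `adj G` itself. Tables grow by one vertex at a time, so only symmetric
-- loopless ones are visited.
allTables-sound : ∀ {n} p → allTables n p ≡ true → (G : Graph n) →
                  ∃ λ t → (∀ i j → t i j ≡ adj G i j) × T (p t)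
allTables-sound {zero}  p h G = (λ ()) , (λ ()) , Equivalence.from T-≡ h
allTables-sound {suc n} p h G
  with t , t≗G , q ← allTables-sound (λ t → allRows n (λ r → p (addVertex r t))) h (deleteZero G)
  = addVertex row t , agree , allRows-sound _ q row
  where
  row : Vec Bool n
  row = Vec.tabulate (λ j → adj G zero (suc j))

  agree : ∀ i j → addVertex row t i j ≡ adj G i j
  agree zero    zero    = sym (irrefl G zero)
  agree zero    (suc j) = lookup∘tabulate _ j
  agree (suc i) zero    = ≡-trans (lookup∘tabulate _ i) (adj-sym G zero (suc i))
  agree (suc i) (suc j) = t≗G i j

-- The seven obstructions and the classification of graphs

cycleAdj : ∀ n → .{{_ : NonZero n}} → Table n
cycleAdj n i j = (suc (toℕ i) % n ≡ᵇ toℕ j) ∨ (suc (toℕ j) % n ≡ᵇ toℕ i)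

cycle : ∀ n → .{{_ : NonZero n}} → (∀ i → cycleAdj n i i ≡ false) → Graph n
cycle n irr = record
  { adj     = cycleAdj n
  ; adj-sym = λ i j → ∨-comm (suc (toℕ i) % n ≡ᵇ toℕ j) _
  ; irrefl  = irr
  }

C₃ : Graph 3
C₃ = cycle 3 (from-yes (Fin.all? λ i → cycleAdj 3 i i Bool.≟ false))

C₄ : Graph 4
C₄ = cycle 4 (from-yes (Fin.all? λ i → cycleAdj 4 i i Bool.≟ false))

C₅ : Graph 5
C₅ = cycle 5 (from-yes (Fin.all? λ i → cycleAdj 5 i i Bool.≟ false))

claw : Graph 4
claw = record
  { adj     = λ i j → isZero i xor isZero j
  ; adj-sym = λ i j → xor-comm (isZero i) (isZero j)
  ; irrefl  = λ i → xor-same (isZero i)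
  }
  where
  isZero : Fin 4 → Bool
  isZero zero    = true
  isZero (suc _) = false

2P₂ : Graph 4
2P₂ = P 2 ⊕ P 2

4P₁ : Graph 4
4P₁ = P 1 ⊕ P 1 ⊕ P 1 ⊕ P 1

P₄+P₁ : Graph 5
P₄+P₁ = P 4 ⊕ P 1

obstructions : List (∃ Graph)
obstructions = (_ , C₃) ∷ (_ , C₄) ∷ (_ , C₅) ∷ (_ , claw) ∷ (_ , 2P₂) ∷ (_ , 4P₁) ∷ (_ , P₄+P₁) ∷ []

Obstructed : ∀ {k} → Graph k → Set
Obstructed H = Any (λ F → InducedSub (proj₂ F) H) obstructions

obstructed : ∀ {n} → Table n → Bool
obstructed t = any (λ F → adj (proj₂ F) ⊑ᵇ t) obstructions

obstructed-sound : ∀ {n} (G : Graph n) {t} → (∀ i j → t i j ≡ adj G i j) →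
                   T (obstructed t) → Obstructed G
obstructed-sound G t≗G p =
  Any.map (λ {F} → ⊑ᵇ-sound (proj₂ F) G (λ _ _ → refl) t≗G) (any⁻ _ obstructions p)

Exceptional : ∀ {k} → Graph k → Set
Exceptional H = InducedSub H (P 4) ⊎ Iso H 3P₁ ⊎ Iso H P₃+P₁ ⊎ Iso H P₂+2P₁

injective⇒surjective : ∀ {n} (f : Fin n → Fin n) → (∀ i j → f i ≡ f j → i ≡ j) →
                       ∀ y → ∃ λ x → f x ≡ y
injective⇒surjective {suc n} f inj y with Fin.any? (λ x → f x Fin.≟ y)
... | yes p = p
-- Deleting a missed value `y` from the codomain would leave an injection of `Fin (suc n)` into
-- `Fin n`.
... | no ¬p = contradiction (Fin.injective⇒≤ {f = λ x → punchOut (missed x)}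
                (λ {i} {j} eq → inj i j (Fin.punchOut-injective (missed i) (missed j) eq)))
                (ℕ.<-irrefl refl)
  where
  missed : ∀ x → y ≢ f x
  missed x eq = ¬p (x , sym eq)

-- For equal orders the embedding is bijective. This turns the search results for the three
-- exceptional graphs into the isomorphisms excluded by the theorem.
spanning⇒Iso : ∀ {n} {F H : Graph n} → InducedSub F H → Iso H F
spanning⇒Iso {F = F} {H} (f , inj , pres) =
  f⁻¹ , f , f-f⁻¹ , (λ j → inj _ _ (f-f⁻¹ (f j))) ,
  λ i j → ≡-trans (sym (pres _ _)) (cong₂ (adj H) (f-f⁻¹ i) (f-f⁻¹ j))
  where
  f⁻¹ = λ y → proj₁ (injective⇒surjective f inj y)
  f-f⁻¹ = λ y → proj₂ (injective⇒surjective f inj y)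

⊑P₄-sound : ∀ {n} (G : Graph n) {t} → (∀ i j → t i j ≡ adj G i j) →
            T (t ⊑ᵇ adj (P 4)) → InducedSub G (P 4)
⊑P₄-sound G t≗G = ⊑ᵇ-sound G (P 4) t≗G (λ _ _ → refl)

-- Evaluation over all `2 ^ 10` labelled graphs.
every₅ : allTables 5 obstructed ≡ true
every₅ = refl

classified₄ : Table 4 → Bool
classified₄ t =
  obstructed t ∨ (t ⊑ᵇ adj (P 4) ∨ (adj P₃+P₁ ⊑ᵇ t ∨ adj P₂+2P₁ ⊑ᵇ t))

every₄ : allTables 4 classified₄ ≡ true
every₄ = refl

classified₃ : Table 3 → Bool
classified₃ t = obstructed t ∨ (t ⊑ᵇ adj (P 4) ∨ adj 3P₁ ⊑ᵇ t)

every₃ : allTables 3 classified₃ ≡ true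
every₃ = refl

∨⁻ : ∀ a {b} → T (a ∨ b) → T a ⊎ T b
∨⁻ a = Equivalence.to (T-∨ {a})

classify₅ : (G : Graph 5) → Obstructed G
classify₅ G = let t , t≗G , p = allTables-sound {5} (obstructed {5}) every₅ G in
  obstructed-sound G t≗G p

classify₄ : (G : Graph 4) → Obstructed G ⊎ Exceptional G
classify₄ G = let t , t≗G , p = allTables-sound classified₄ every₄ G in
  Sum.map (obstructed-sound G t≗G)
    (Sum.map (⊑P₄-sound G {t} t≗G)
      (λ q → inj₂ (Sum.map
        (λ r → spanning⇒Iso {F = P₃+P₁} {G} (⊑ᵇ-sound P₃+P₁ G {t = t} (λ _ _ → refl) t≗G r))
        (λ r → spanning⇒Iso {F = P₂+2P₁} {G} (⊑ᵇ-sound P₂+2P₁ G {t = t} (λ _ _ → refl) t≗G r))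
        (∨⁻ (adj P₃+P₁ ⊑ᵇ t) q)))
      ∘ ∨⁻ (t ⊑ᵇ adj (P 4)))
    (∨⁻ (obstructed t) p)

classify₃ : (G : Graph 3) → Obstructed G ⊎ Exceptional G
classify₃ G = let t , t≗G , p = allTables-sound classified₃ every₃ G in
  Sum.map (obstructed-sound G t≗G)
    (Sum.map (⊑P₄-sound G {t} t≗G)
      (λ q → inj₁ (spanning⇒Iso {F = 3P₁} {G} (⊑ᵇ-sound 3P₁ G {t = t} (λ _ _ → refl) t≗G q)))
      ∘ ∨⁻ (t ⊑ᵇ adj (P 4)))
    (∨⁻ (obstructed t) p)

allTables⇒⊑P₄ : ∀ {n} → allTables n (_⊑ᵇ adj (P 4)) ≡ true → (G : Graph n) → InducedSub G (P 4)
allTables⇒⊑P₄ h G = let t , t≗G , p = allTables-sound (_⊑ᵇ adj (P 4)) h G in ⊑P₄-sound G {t} t≗G p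

firstVertices : ∀ a {b} → Graph (a + b) → Graph a
firstVertices a {b} G = record
  { adj     = λ i j → adj G (i ↑ˡ b) (j ↑ˡ b)
  ; adj-sym = λ i j → adj-sym G _ _
  ; irrefl  = λ i → irrefl G _
  }

firstVertices-⊑ : ∀ a {b} (G : Graph (a + b)) → InducedSub (firstVertices a G) G
firstVertices-⊑ a {b} G = (_↑ˡ b) , Fin.↑ˡ-injective b , λ _ _ → refl

classify : ∀ k (H : Graph k) → Obstructed H ⊎ Exceptional H
-- Every graph on at most two vertices embeds in `P 4`.
classify 0 H = inj₂ (inj₁ (allTables⇒⊑P₄ refl H))
classify 1 H = inj₂ (inj₁ (allTables⇒⊑P₄ refl H))
classify 2 H = inj₂ (inj₁ (allTables⇒⊑P₄ refl H))
classify 3 H = classify₃ H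
classify 4 H = classify₄ H
classify (suc (suc (suc (suc (suc k))))) H =
  inj₁ (Any.map (λ {F} F⊑ → InducedSub-trans {F = proj₂ F} {firstVertices 5 H} {H} F⊑ (firstVertices-⊑ 5 H))
         (classify₅ (firstVertices 5 H)))

-- Fooling sets for the two-party simulation

-- For each pass, the state handed from Alice to Bob and the state handed back for the next pass.
transcript : ∀ {n} {S : Set} p → (Fin p → S → Item n → S) →
             List (Item n) → List (Item n) → S → Vec (S × S) p
transcript zero    δ xs ys s = []
transcript (suc p) δ xs ys s = (a , b) ∷ transcript p (δ ∘ suc) xs ys b
  where
  a = foldl (δ zero) s xs
  b = foldl (δ zero) a ys

-- Cut and paste: in the mixed run Alice's half leads to the shared state `a`, from which Bob's half
-- leads to `b′`, equal to `b`, so the next pass again starts in a shared state.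
crossing : ∀ {n} {S : Set} p (δ : Fin p → S → Item n → S) {xs ys xs′ ys′ s} →
           transcript p δ xs ys s ≡ transcript p δ xs′ ys′ s →
           runPasses p δ (xs ++ ys′) s ≡ runPasses p δ (xs ++ ys) s
crossing zero    δ eq = refl
crossing (suc p) δ {xs} {ys} {xs′} {ys′} {s} eq = begin
  runPasses p (δ ∘ suc) (xs ++ ys′) (foldl (δ zero) s (xs ++ ys′))
    ≡⟨ cong (runPasses p (δ ∘ suc) (xs ++ ys′)) same-state ⟩
  runPasses p (δ ∘ suc) (xs ++ ys′) b
    -- The second transcript continues from `b′`; it is moved to `b` because the induction
    -- hypothesis needs one common starting state.
    ≡⟨ crossing p (δ ∘ suc) (≡-trans (proj₂ (∷-injective eq))
         (cong (transcript p (δ ∘ suc) xs′ ys′) (sym b≡b′))) ⟩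
  runPasses p (δ ∘ suc) (xs ++ ys) b
    ≡⟨ cong (runPasses p (δ ∘ suc) (xs ++ ys)) (foldl-++ (δ zero) s xs ys) ⟨
  runPasses p (δ ∘ suc) (xs ++ ys) (foldl (δ zero) s (xs ++ ys)) ∎
  where
  open ≡-Reasoning
  a  = foldl (δ zero) s xs
  b  = foldl (δ zero) a ys
  a′ = foldl (δ zero) s xs′
  b′ = foldl (δ zero) a′ ys′
  a≡a′ : a ≡ a′
  a≡a′ = ,-injectiveˡ (proj₁ (∷-injective eq))
  b≡b′ : b ≡ b′
  b≡b′ = ,-injectiveʳ (proj₁ (∷-injective eq))
  same-state : foldl (δ zero) s (xs ++ ys′) ≡ b
  same-state = begin
    foldl (δ zero) s (xs ++ ys′) ≡⟨ foldl-++ (δ zero) s xs ys′ ⟩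
    foldl (δ zero) a ys′         ≡⟨ cong (λ z → foldl (δ zero) z ys′) a≡a′ ⟩
    b′                           ≡⟨ b≡b′ ⟨
    b                            ∎

-- Numbers the transcripts for the pigeonhole principle; for `M = 2 ^ m` there are
-- `2 ^ ((m + m) * p)` codes.
encode : ∀ {M p} → Vec (Fin M × Fin M) p → Fin ((M * M) ^ p)
encode []            = zero
encode ((a , b) ∷ v) = combine (combine a b) (encode v)

encode-injective : ∀ {M p} (u v : Vec (Fin M × Fin M) p) → encode u ≡ encode v → u ≡ v
encode-injective []            []              _ = refl
encode-injective ((a , b) ∷ u) ((a′ , b′) ∷ v) eq
  with eq₁ , eq₂ ← Fin.combine-injective _ (encode u) _ (encode v) eq
  with refl , refl ← Fin.combine-injective a b a′ b′ eq₁
  = cong (_ ∷_) (encode-injective u v eq₂)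

Bits : ℕ → Set
Bits N = Fin N → Bool

↔-injective : ∀ {X Y : Set} (f : X ↔ Y) {i j} → Inverse.to f i ≡ Inverse.to f j → i ≡ j
↔-injective f = Injection.injective (↔⇒↣ f)

bits : ∀ N → Fin (2 ^ N) → Bits N
bits N k = Inverse.to Fin.2↔Bool ∘ finToFun k

funToFin-cong : ∀ {m n} (f g : Fin m → Fin n) → (∀ i → f i ≡ g i) → funToFin f ≡ funToFin g
funToFin-cong {zero}  f g eq = refl
funToFin-cong {suc m} f g eq = cong₂ combine (eq zero) (funToFin-cong _ _ (eq ∘ suc))

bits-injective : ∀ {N} {k l : Fin (2 ^ N)} → (∀ i → bits N k i ≡ bits N l i) → k ≡ l
bits-injective {N} {k} {l} eq = begin
  k                             ≡⟨ Fin.funToFin-finToFin {N} {2} k ⟨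
  funToFin (finToFun {2} {N} k) ≡⟨ funToFin-cong _ _ (↔-injective Fin.2↔Bool ∘ eq) ⟩
  funToFin (finToFun {2} {N} l) ≡⟨ Fin.funToFin-finToFin {N} {2} l ⟩
  l                             ∎
  where open ≡-Reasoning

bits-differ : ∀ {N} {k l : Fin (2 ^ N)} → k ≢ l → ∃ λ i → bits N k i ≢ bits N l i
bits-differ {N} {k} {l} k≢l =
  Fin.¬∀⟶∃¬ N _ (λ i → bits N k i Bool.≟ bits N l i) (k≢l ∘ bits-injective)

-- The counterpart of `Reach` for a relation on any vertex type; as `here` has any index, the index
-- only bounds the length from above.
data Walk {V : Set} (E : V → V → Set) : ℕ → V → V → Set where
  here : ∀ {k s} → Walk E k s s
  step : ∀ {k s u t} → E s u → Walk E k u t → Walk E (suc k) s t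

Walk-mono : ∀ {V : Set} {E : V → V → Set} {k l s t} → k ≤ l → Walk E k s t → Walk E l s t
Walk-mono _           here       = here
Walk-mono (ℕ.s≤s k≤l) (step e w) = step e (Walk-mono k≤l w)

Walk-++ : ∀ {V : Set} {E : V → V → Set} {k l s t u} → Walk E k s t → Walk E l t u → Walk E (k + l) s u
Walk-++ {k = k} here w = Walk-mono (ℕ.m≤n+m _ k) w
Walk-++ (step e w) w′  = step e (Walk-++ w w′)

Walk-sym : ∀ {V : Set} {E : V → V → Set} → (∀ {p q} → E p q → E q p) →
           ∀ {k s t} → Walk E k s t → Walk E k t s
Walk-sym E-sym here = here
Walk-sym {E = E} E-sym (step {k} {s} {u} {t} e w) =
  subst (λ n → Walk E n t s) (ℕ.+-comm k 1) (Walk-++ (Walk-sym E-sym w) (step (E-sym e) (here {k = 0})))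

-- Alice owns the vertices in A and the input x, Bob those in B and the input y;
-- localˡ and localʳ say that each of them knows the lists of his own vertices.
record Family (N D : ℕ) (A B : Set) : Set₁ where
  field
    Adj      : Bits N → Bits N → A ⊎ B → A ⊎ B → Set
    Adj?     : ∀ x y u v → Dec (Adj x y u v)
    Adj-sym  : ∀ {x y u v} → Adj x y u v → Adj x y v u
    Adj-irr  : ∀ {x y u} → ¬ Adj x y u u
    localˡ   : ∀ {x y y′ a v} → Adj x y (inj₁ a) v → Adj x y′ (inj₁ a) v
    localʳ   : ∀ {x x′ y b v} → Adj x y (inj₂ b) v → Adj x′ y (inj₂ b) v
    close    : ∀ x u v → Walk (Adj x x) D u v
    far      : ∀ {x y} i → x i ≡ false → y i ≡ true → ∃₂ λ u v → ¬ Walk (Adj x y) D u v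

-- The counterpart of `InducedSub` for adjacency given as a relation, so that families are analysed
-- without numbering their vertices.
record Occurs {k} (F : Graph k) {V : Set} (E : V → V → Set) : Set where
  field
    at       : Fin k → V
    distinct : ∀ i j → i ≢ j → at i ≢ at j
    edge     : ∀ i j → adj F i j ≡ true → E (at i) (at j)
    nonedge  : ∀ i j → adj F i j ≡ false → ¬ E (at i) (at j)

Reach-mono : ∀ {n d d′} {G : Graph n} {s t} → d ≤ d′ → Reach G d s t → Reach G d′ s t
Reach-mono _            here       = here
Reach-mono (ℕ.s≤s d≤d′) (step e r) = step e (Reach-mono d≤d′ r)

-- A finite answer is at most `d` by minimality in `G` and bounds all distances in `G′`; the
-- infinite answer contradicts closeness in `G`.
IsDiameter⇒close : ∀ {n} {G G′ : Graph n} {d} o → IsDiameter G o → IsDiameter G′ o →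
                   (∀ s t → Reach G d s t) → ∀ s t → Reach G′ d s t
IsDiameter⇒close (just _) (_ , least) (all , _) close s t = Reach-mono (least _ close) (all s t)
IsDiameter⇒close nothing  (s , t , far) _       close = contradiction (close s t) (far _)

tabulate-+ : ∀ {X : Set} a {b} (f : Fin (a + b) → X) →
             tabulate f ≡ tabulate (λ i → f (i ↑ˡ b)) ++ tabulate (λ j → f (a ↑ʳ j))
tabulate-+ zero    f = refl
tabulate-+ (suc a) f = cong (f zero ∷_) (tabulate-+ a (f ∘ suc))

module _ {N D α β : ℕ} {A B : Set} (𝓕 : Family N D A B) (enumA : Fin α ↔ A) (enumB : Fin β ↔ B) where
  open Family 𝓕

  vertices : Fin (α + β) ↔ (A ⊎ B)
  vertices = (enumA ⊎-↔ enumB) ↔-∘ Fin.+↔⊎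

  vertex : Fin (α + β) → A ⊎ B
  vertex = Inverse.to vertices

  index : A ⊎ B → Fin (α + β)
  index = Inverse.from vertices

  vertex-index : ∀ v → vertex (index v) ≡ v
  vertex-index v = Inverse.strictlyInverseˡ vertices v

  index-vertex : ∀ i → index (vertex i) ≡ i
  index-vertex i = Inverse.strictlyInverseʳ vertices i

  -- The transition function of an algorithm may tell apart neighbourhoods that are
  -- only pointwise equal, so these rows must not mention the other player's input.
  rowA : Bits N → Fin α → Fin (α + β) → Bool
  rowA x i j = does (Adj? x (λ _ → false) (inj₁ (Inverse.to enumA i)) (vertex j))

  rowB : Bits N → Fin β → Fin (α + β) → Bool
  rowB y i j = does (Adj? (λ _ → false) y (inj₂ (Inverse.to enumB i)) (vertex j))

  rows : Bits N → Bits N → Fin (α + β) → Fin (α + β) → Bool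
  rows x y i = [ rowA x , rowB y ]′ (splitAt α i)

  -- By locality the all-false placeholder for the other player's input may be replaced by the
  -- actual input.
  rows-Adj : ∀ x y i j → rows x y i j ≡ does (Adj? x y (vertex i) (vertex j))
  rows-Adj x y i j with splitAt α i
  ... | inj₁ _ = does-⇔ (mk⇔ localˡ localˡ) (Adj? _ _ _ _) (Adj? _ _ _ _)
  ... | inj₂ _ = does-⇔ (mk⇔ localʳ localʳ) (Adj? _ _ _ _) (Adj? _ _ _ _)

  graph : Bits N → Bits N → Graph (α + β)
  graph x y = record
    { adj     = rows x y
    ; adj-sym = λ i j → ≡-trans (rows-Adj x y i j) (≡-trans
        (does-⇔ (mk⇔ Adj-sym Adj-sym) (Adj? x y _ _) (Adj? x y _ _)) (sym (rows-Adj x y j i)))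
    ; irrefl  = λ i → ≡-trans (rows-Adj x y i i) (dec-false (Adj? x y _ _) Adj-irr)
    }

  adj⇒Adj : ∀ {x y i j} → rows x y i j ≡ true → Adj x y (vertex i) (vertex j)
  adj⇒Adj {x} {y} {i} {j} eq with Adj? x y (vertex i) (vertex j) | ≡-trans (sym (rows-Adj x y i j)) eq
  ... | yes p | _ = p

  Adj⇒adj : ∀ {x y i j} → Adj x y (vertex i) (vertex j) → rows x y i j ≡ true
  Adj⇒adj {x} {y} p = ≡-trans (rows-Adj x y _ _) (dec-true (Adj? x y _ _) p)

  Reach⇒Walk : ∀ {x y d i j} → Reach (graph x y) d i j → Walk (Adj x y) d (vertex i) (vertex j)
  Reach⇒Walk here = here
  Reach⇒Walk {x} {y} (step {u = u} e r) = step (adj⇒Adj {x} {y} {j = u} e) (Reach⇒Walk r)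

  Walk⇒Reach : ∀ {x y d u v} → Walk (Adj x y) d u v → Reach (graph x y) d (index u) (index v)
  Walk⇒Reach here = here
  Walk⇒Reach {x} {y} (step {s = s} {u = u} e w) =
    step (Adj⇒adj {x} {y} (subst (λ z → Adj x y z _) (sym (vertex-index s))
           (subst (Adj x y s) (sym (vertex-index u)) e)))
      (Walk⇒Reach w)

  InducedSub⇒Occurs : ∀ {k x y} {F : Graph k} → InducedSub F (graph x y) → Occurs F (Adj x y)
  InducedSub⇒Occurs {x = x} {y} (f , inj , pres) = record
    { at       = vertex ∘ f
    ; distinct = λ i j i≢j eq → i≢j (inj i j (↔-injective vertices eq))
    ; edge     = λ i j eq → adj⇒Adj {x} {y} (≡-trans (pres i j) eq)
    ; nonedge  = λ i j eq e → contradiction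
        (≡-trans (sym (Adj⇒adj {x} {y} e)) (≡-trans (pres i j) eq)) λ ()
    }

  reach-close : ∀ x i j → Reach (graph x x) D i j
  reach-close x i j = subst (λ z → Reach _ D z j) (index-vertex i)
    (subst (Reach _ D _) (index-vertex j) (Walk⇒Reach (close x (vertex i) (vertex j))))

  ¬reach-far : ∀ {x y} i → x i ≡ false → y i ≡ true → ¬ (∀ s t → Reach (graph x y) D s t)
  ¬reach-far {x} {y} i xi yi all with u , v , ¬w ← far {x} {y} i xi yi =
    ¬w (subst (λ z → Walk _ D z v) (vertex-index u)
         (subst (Walk _ D _) (vertex-index v) (Reach⇒Walk (all (index u) (index v)))))

  listA : Bits N → List (Item (α + β))
  listA x = tabulate λ i → i ↑ˡ β , rowA x i

  listB : Bits N → List (Item (α + β))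
  listB y = tabulate λ j → α ↑ʳ j , rowB y j

  -- In the identity order Alice's vertices come first, so the stream falls into two halves, each
  -- depending on one input only.
  stream-split : ∀ x y → stream (graph x y) id ≡ listA x ++ listB y
  stream-split x y = begin
    map (item (graph x y)) (allFin (α + β))
      ≡⟨ map-tabulate (λ i → i) (item (graph x y)) ⟩
    tabulate (item (graph x y))
      ≡⟨ tabulate-+ α (item (graph x y)) ⟩
    tabulate (λ i → item (graph x y) (i ↑ˡ β)) ++ tabulate (λ j → item (graph x y) (α ↑ʳ j))
      ≡⟨ cong₂ _++_
           (tabulate-cong λ i → cong (λ s → i ↑ˡ β , [ rowA x , rowB y ]′ s) (Fin.splitAt-↑ˡ α i β))
           (tabulate-cong λ j → cong (λ s → α ↑ʳ j , [ rowA x , rowB y ]′ s) (Fin.splitAt-↑ʳ α β j)) ⟩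
    listA x ++ listB y ∎
    where open ≡-Reasoning

  transcriptOf : ∀ {p m} → Alg (α + β) p m → Bits N → Bits N → Vec (Fin (2 ^ m) × Fin (2 ^ m)) p
  transcriptOf {p} 𝓐 x y = transcript p (trans 𝓐) (listA x) (listB y) (init 𝓐)

  run-mixed : ∀ {p m} (𝓐 : Alg (α + β) p m) x x′ →
              transcriptOf 𝓐 x x ≡ transcriptOf 𝓐 x′ x′ →
              run 𝓐 (stream (graph x x′) id) ≡ run 𝓐 (stream (graph x x) id)
  run-mixed {p} 𝓐 x x′ eq = begin
    run 𝓐 (stream (graph x x′) id)      ≡⟨ cong (run 𝓐) (stream-split x x′) ⟩
    run 𝓐 (listA x ++ listB x′)         ≡⟨ cong (output 𝓐) (crossing p (trans 𝓐) eq) ⟩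
    run 𝓐 (listA x ++ listB x)          ≡⟨ cong (run 𝓐) (stream-split x x) ⟨
    run 𝓐 (stream (graph x x) id)       ∎
    where open ≡-Reasoning

  Correct : ∀ {p m} → Alg (α + β) p m → Set
  Correct 𝓐 = ∀ x y → IsDiameter (graph x y) (run 𝓐 (stream (graph x y) id))

  mixed-close : ∀ {p m} (𝓐 : Alg (α + β) p m) → Correct 𝓐 → ∀ x x′ →
                transcriptOf 𝓐 x x ≡ transcriptOf 𝓐 x′ x′ →
                ∀ s t → Reach (graph x x′) D s t
  mixed-close 𝓐 correct x x′ eq =
    IsDiameter⇒close {G = graph x x} {graph x x′} (run 𝓐 (stream (graph x x) id)) (correct x x)
      (subst (IsDiameter (graph x x′)) (run-mixed 𝓐 x x′ eq) (correct x x′)) (reach-close x)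

  -- The input with a `0` at `i` is given to Alice and the other to Bob; equal transcripts would
  -- make this mixed graph close, but it is far.
  transcripts-differ : ∀ {p m} (𝓐 : Alg (α + β) p m) → Correct 𝓐 → ∀ x x′ i → x i ≢ x′ i →
                       transcriptOf 𝓐 x x ≢ transcriptOf 𝓐 x′ x′
  transcripts-differ 𝓐 correct x x′ i x≢x′ eq with x i in xi | x′ i in x′i
  ... | false | true  = ¬reach-far i xi x′i (mixed-close 𝓐 correct x x′ eq)
  ... | true  | false = ¬reach-far i x′i xi (mixed-close 𝓐 correct x′ x (sym eq))
  ... | false | false = x≢x′ refl
  ... | true  | true  = x≢x′ refl

  memory-bound : ∀ {p m} (𝓐 : Alg (α + β) p m) → Correct 𝓐 → N ≤ (m + m) * p
  memory-bound {p} {m} 𝓐 correct with N ℕ.≤? (m + m) * p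
  ... | yes N≤ = N≤
  ... | no N≰ =
    let k , l , k<l , eq = Fin.pigeonhole few (λ k → encode (transcriptOf 𝓐 (bits N k) (bits N k)))
        i , differ = bits-differ {N} {k} {l} (Fin.<⇒≢ k<l)
    in contradiction (encode-injective _ _ eq) (transcripts-differ 𝓐 correct _ _ i differ)
    where
    few : (2 ^ m * 2 ^ m) ^ p < 2 ^ N
    few = subst (_< 2 ^ N)
      (≡-trans (sym (ℕ.^-*-assoc 2 (m + m) p)) (cong (_^ p) (ℕ.^-distribˡ-+-* 2 m m)))
      (ℕ.^-monoʳ-< 2 (ℕ.s≤s (ℕ.s≤s ℕ.z≤n)) (ℕ.≰⇒> N≰))

-- Split graphs and graphs covered by three cliques

-- The last summand holds `hᴮ`, one vertex `wᴮ zero`, and `r` twins of the latter that pad the graph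
-- to a prescribed order.
CliqueVertex : ℕ → ℕ → Set
CliqueVertex N r = (Fin N ⊎ Fin N) ⊎ (Fin N ⊎ Fin (2 + r))

pattern uᴬ i = inj₁ (inj₁ i)
pattern kᴬ i = inj₁ (inj₂ i)
pattern vᴮ i = inj₂ (inj₁ i)
pattern zᴮ z = inj₂ (inj₂ z)
pattern hᴮ   = inj₂ (inj₂ zero)
pattern wᴮ z = inj₂ (inj₂ (suc z))

_≟ᶜ_ : ∀ {N r} (p q : CliqueVertex N r) → Dec (p ≡ q)
_≟ᶜ_ = ≡-dec (≡-dec Fin._≟_ Fin._≟_) (≡-dec Fin._≟_ Fin._≟_)

-- The vertices uᴬ i, the vertices vᴮ i and the remaining ones form three parts, the last
-- being a clique; the first two are cliques or independent sets depending on ι.  For i ≠ j the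
-- vertices uᴬ i and vᴮ j have the common neighbour kᴬ j, whereas uᴬ i and vᴮ i have one only if
-- x i = 1 (then kᴬ i) or y i = 0 (then hᴮ).
link : ∀ {N r} → Bool → Bits N → Bits N → CliqueVertex N r → CliqueVertex N r → Bool
link ι x y (uᴬ i) (uᴬ j) = ι
link ι x y (uᴬ i) (kᴬ j) = x i ∨ not ⌊ i Fin.≟ j ⌋
link ι x y (uᴬ i) hᴮ     = true
link ι x y (vᴮ i) (vᴮ j) = ι
link ι x y (vᴮ i) (kᴬ j) = ⌊ i Fin.≟ j ⌋
link ι x y (vᴮ i) hᴮ     = not (y i)
link ι x y (vᴮ i) (wᴮ _) = true
link ι x y (kᴬ _) (kᴬ _) = true
link ι x y (kᴬ _) (zᴮ _) = true
link ι x y (zᴮ _) (zᴮ _) = true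
link ι x y _      _      = false

-- `link` treats each kind of pair in one order only, hence the disjunction; loops are removed in
-- `CliqueAdj`.
Linked : ∀ {N r} → Bool → Bits N → Bits N → CliqueVertex N r → CliqueVertex N r → Set
Linked ι x y p q = T (link ι x y p q ∨ link ι x y q p)

CliqueAdj : ∀ {N r} → Bool → Bits N → Bits N → CliqueVertex N r → CliqueVertex N r → Set
CliqueAdj ι x y p q = p ≢ q × Linked ι x y p q

Linked-sym : ∀ {N r} ι x y (p q : CliqueVertex N r) → Linked ι x y p q → Linked ι x y q p
Linked-sym ι x y p q = subst T (∨-comm (link ι x y p q) _)

module _ {N r : ℕ} (ι : Bool) where

  -- The input `x` matters only between `uᴬ` and `kᴬ`, and `y` only between `vᴮ` and `hᴮ`; edges
  -- between the players are fixed.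
  link-localˡ : ∀ x y y′ a (q : CliqueVertex N r) → Linked ι x y (inj₁ a) q → Linked ι x y′ (inj₁ a) q
  link-localˡ x y y′ (inj₁ i) (uᴬ j) l = l
  link-localˡ x y y′ (inj₁ i) (kᴬ j) l = l
  link-localˡ x y y′ (inj₁ i) hᴮ     l = l
  link-localˡ x y y′ (inj₂ i) (uᴬ j) l = l
  link-localˡ x y y′ (inj₂ i) (kᴬ j) l = l
  link-localˡ x y y′ (inj₂ i) (vᴮ j) l = l
  link-localˡ x y y′ (inj₂ i) (zᴮ _) l = l

  link-localʳ : ∀ x x′ y b (q : CliqueVertex N r) → Linked ι x y (inj₂ b) q → Linked ι x′ y (inj₂ b) q
  link-localʳ x x′ y (inj₁ i)       (kᴬ j) l = l
  link-localʳ x x′ y (inj₁ i)       (vᴮ j) l = l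
  link-localʳ x x′ y (inj₁ i)       hᴮ     l = l
  link-localʳ x x′ y (inj₁ i)       (wᴮ _) l = l
  link-localʳ x x′ y (inj₂ zero)    (uᴬ j) l = l
  link-localʳ x x′ y (inj₂ zero)    (kᴬ j) l = l
  link-localʳ x x′ y (inj₂ zero)    (vᴮ j) l = l
  link-localʳ x x′ y (inj₂ zero)    (zᴮ _) l = l
  link-localʳ x x′ y (inj₂ (suc _)) (kᴬ j) l = l
  link-localʳ x x′ y (inj₂ (suc _)) (vᴮ j) l = l
  link-localʳ x x′ y (inj₂ (suc _)) (zᴮ _) l = l

  -- A midpoint may coincide with an end: the loop is then dropped and the walk gets shorter.
  link-step : ∀ {x y n p m q} → Linked {N} {r} ι x y p m → Walk (CliqueAdj ι x y) n m q →
              Walk (CliqueAdj ι x y) (suc n) p q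
  link-step {p = p} {m} l w with p ≟ᶜ m
  ... | yes refl = Walk-mono (ℕ.n≤1+n _) w
  ... | no p≢m   = step (p≢m , l) w

  via : ∀ {x y p q} m → Linked {N} {r} ι x y p m → Linked ι x y q m → Walk (CliqueAdj ι x y) 2 p q
  via {x} {y} {p} {q} m l l′ = link-step l (link-step (Linked-sym ι x y q m l′) here)

  reflexive-link : ∀ x i → Linked {N} {r} ι x x (vᴮ i) (kᴬ i)
  reflexive-link x i with i Fin.≟ i
  ... | yes _  = _
  ... | no i≢i = contradiction refl i≢i

  u-v-close : ∀ x i j → ∃ λ m → Linked {N} {r} ι x x (uᴬ i) m × Linked ι x x (vᴮ j) m
  u-v-close x i j with x i in xi
  ... | true  = kᴬ j , subst T (sym (cong (λ b → (b ∨ not ⌊ i Fin.≟ j ⌋) ∨ false) xi)) _ , reflexive-link x j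
  ... | false with i Fin.≟ j in i≟j
  ... | yes refl = hᴮ , _ , subst T (sym (cong (λ b → not b ∨ false) xi)) _
  ... | no _     = kᴬ j , subst T (sym (cong₂ (λ b d → (b ∨ not ⌊ d ⌋) ∨ false) xi i≟j)) _ , reflexive-link x j

  -- Every `uᴬ`, `kᴬ` and `zᴮ` is linked to `hᴮ`, and every `vᴮ`, `kᴬ` and `zᴮ` to `wᴮ zero`; only
  -- pairs of a `uᴬ` and a `vᴮ` need the input.
  clique-close : ∀ x p q → Walk (CliqueAdj {N} {r} ι x x) 2 p q
  clique-close x (uᴬ i) (uᴬ j) = via hᴮ _ _
  clique-close x (uᴬ i) (kᴬ j) = via hᴮ _ _
  clique-close x (uᴬ i) (zᴮ _) = via hᴮ _ _
  clique-close x (kᴬ i) (uᴬ j) = via hᴮ _ _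
  clique-close x (zᴮ _) (uᴬ j) = via hᴮ _ _
  clique-close x (uᴬ i) (vᴮ j) = let m , l , l′ = u-v-close x i j in via m l l′
  clique-close x (vᴮ j) (uᴬ i) = let m , l , l′ = u-v-close x i j in via m l′ l
  clique-close x (kᴬ i) (kᴬ j) = via (wᴮ zero) _ _
  clique-close x (kᴬ i) (vᴮ j) = via (wᴮ zero) _ _
  clique-close x (kᴬ i) (zᴮ _) = via (wᴮ zero) _ _
  clique-close x (vᴮ i) (kᴬ j) = via (wᴮ zero) _ _
  clique-close x (vᴮ i) (vᴮ j) = via (wᴮ zero) _ _
  clique-close x (vᴮ i) (zᴮ _) = via (wᴮ zero) _ _
  clique-close x (zᴮ _) (kᴬ j) = via (wᴮ zero) _ _
  clique-close x (zᴮ _) (vᴮ j) = via (wᴮ zero) _ _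
  clique-close x (zᴮ _) (zᴮ _) = via (wᴮ zero) _ _

  clique-far : ∀ {x y} i → x i ≡ false → y i ≡ true →
               ∃₂ λ p q → ¬ Walk (CliqueAdj {N} {r} ι x y) 2 p q
  clique-far {x} {y} i xi yi = uᴬ i , vᴮ i , no-walk
    where
    no-walk : ¬ Walk (CliqueAdj {N} {r} ι x y) 2 (uᴬ i) (vᴮ i)
    -- Only a `kᴬ` or `hᴮ` could be the midpoint. For `kᴬ j`, the edge to `uᴬ i` needs `i ≢ j` and
    -- the edge to `vᴮ i` needs `i ≡ j`.
    no-walk (step {u = kᴬ j} (_ , l) (step (_ , l′) here)) rewrite xi with i Fin.≟ j
    ... | yes _ = l
    ... | no _  = l′
    no-walk (step {u = hᴮ} (_ , l) (step (_ , l′) here)) rewrite yi = l′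

  cliqueFamily : Family N 2 (Fin N ⊎ Fin N) (Fin N ⊎ Fin (2 + r))
  cliqueFamily = record
    { Adj     = CliqueAdj ι
    ; Adj?    = λ x y p q → ¬? (p ≟ᶜ q) ×-dec T? (link ι x y p q ∨ link ι x y q p)
    ; Adj-sym = λ {x} {y} {p} {q} (p≢q , l) → p≢q ∘ sym , Linked-sym ι x y p q l
    ; Adj-irr = λ (p≢p , _) → p≢p refl
    ; localˡ  = λ {x} {y} {y′} {a} {q} (p≢q , l) → p≢q , link-localˡ x y y′ a q l
    ; localʳ  = λ {x} {x′} {y} {b} {q} (p≢q , l) → p≢q , link-localʳ x x′ y b q l
    ; close   = clique-close
    ; far     = clique-far
    }

-- Excluded subgraphs via the three parts

part : ∀ {N r} → CliqueVertex N r → Fin 3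
part (uᴬ _) = 0F
part (vᴮ _) = 1F
part (kᴬ _) = 2F
part (zᴮ _) = 2F

same-part : (a b c d : Fin 3) → a ≢ c → a ≢ d → c ≢ d → b ≢ c → b ≢ d → a ≡ b
same-part = from-yes (Fin.all? {n = 3} λ a → Fin.all? {n = 3} λ b →
  Fin.all? {n = 3} λ c → Fin.all? {n = 3} λ d →
  ¬? (a Fin.≟ c) →-dec ¬? (a Fin.≟ d) →-dec ¬? (c Fin.≟ d) →-dec
  ¬? (b Fin.≟ c) →-dec ¬? (b Fin.≟ d) →-dec (a Fin.≟ b))

module _ {N r : ℕ} {x y : Bits N} where

  third-part-clique : ∀ {ι} (p q : CliqueVertex N r) → part p ≡ 2F → part q ≡ 2F → p ≢ q →
                      CliqueAdj ι x y p q
  third-part-clique (kᴬ _) (kᴬ _) _ _ p≢q = p≢q , _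
  third-part-clique (kᴬ _) (zᴮ _) _ _ p≢q = p≢q , _
  third-part-clique (zᴮ _) (kᴬ _) _ _ p≢q = p≢q , _
  third-part-clique (zᴮ _) (zᴮ _) _ _ p≢q = p≢q , _

  part-clique : (p q : CliqueVertex N r) → part p ≡ part q → p ≢ q → CliqueAdj true x y p q
  part-clique (uᴬ _) (uᴬ _) _ p≢q = p≢q , _
  part-clique (vᴮ _) (vᴮ _) _ p≢q = p≢q , _
  part-clique (uᴬ _) (vᴮ _) ()
  part-clique (uᴬ _) (zᴮ _) ()
  part-clique (vᴮ _) (uᴬ _) ()
  part-clique (vᴮ _) (kᴬ _) ()
  part-clique (kᴬ _) q      e p≢q = third-part-clique _ q refl (sym e) p≢q
  part-clique (zᴮ _) q      e p≢q = third-part-clique _ q refl (sym e) p≢q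

  cross-edge : ∀ {ι} (p q : CliqueVertex N r) → CliqueAdj ι x y p q → part p ≢ part q →
               part p ≡ 2F ⊎ part q ≡ 2F
  cross-edge (kᴬ _) q      _ _  = inj₁ refl
  cross-edge (zᴮ _) q      _ _  = inj₁ refl
  cross-edge p      (kᴬ _) _ _  = inj₂ refl
  cross-edge p      (zᴮ _) _ _  = inj₂ refl
  cross-edge (uᴬ _) (uᴬ _) _ ne = contradiction refl ne
  cross-edge (vᴮ _) (vᴮ _) _ ne = contradiction refl ne

  split-edge : (p q : CliqueVertex N r) → CliqueAdj false x y p q → part p ≡ 2F ⊎ part q ≡ 2F
  split-edge (kᴬ _) q      _ = inj₁ refl
  split-edge (zᴮ _) q      _ = inj₁ refl
  split-edge p      (kᴬ _) _ = inj₂ refl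
  split-edge p      (zᴮ _) _ = inj₂ refl

  -- In the third part `uᴬ i` can miss only `kᴬ i` and the `wᴮ`, and the latter are adjacent to
  -- every `vᴮ`.
  u-nonneighbour : ∀ {ι} i j (p : CliqueVertex N r) → part p ≡ 2F →
                   ¬ CliqueAdj ι x y (uᴬ i) p → ¬ CliqueAdj ι x y (vᴮ j) p → p ≡ kᴬ i
  u-nonneighbour {ι} i j (kᴬ l) _ p≁l _ with i Fin.≟ l
  ... | yes refl = refl
  ... | no _     = contradiction ((λ ()) , t) p≁l
    where
    t : T ((x i ∨ true) ∨ false)
    t with x i
    ... | true  = _
    ... | false = _
  u-nonneighbour i j hᴮ     _ p≁l _   = contradiction ((λ ()) , _) p≁l
  u-nonneighbour i j (wᴮ _) _ _   q≁l = contradiction ((λ ()) , _) q≁l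

  -- Both `l` and `m` equal `kᴬ i` for the one `uᴬ i` among `p` and `q`. In a copy of `P₄+P₁` this
  -- would identify the two path vertices in the third part.
  common-nonneighbour : ∀ {ι} (p q l m : CliqueVertex N r) →
    part p ≢ 2F → part q ≢ 2F → part p ≢ part q → part l ≡ 2F → part m ≡ 2F →
    ¬ CliqueAdj ι x y p l → ¬ CliqueAdj ι x y p m →
    ¬ CliqueAdj ι x y q l → ¬ CliqueAdj ι x y q m → l ≡ m
  common-nonneighbour (uᴬ i) (vᴮ j) l m _ _ _ el em pl pm ql qm =
    ≡-trans (u-nonneighbour i j l el pl ql) (sym (u-nonneighbour i j m em pm qm))
  common-nonneighbour (vᴮ j) (uᴬ i) l m _ _ _ el em pl pm ql qm =
    ≡-trans (u-nonneighbour i j l el ql pl) (sym (u-nonneighbour i j m em qm pm))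
  common-nonneighbour (uᴬ _) (uᴬ _) _ _ _  _  ne = contradiction refl ne
  common-nonneighbour (vᴮ _) (vᴮ _) _ _ _  _  ne = contradiction refl ne
  common-nonneighbour (kᴬ _) _      _ _ ne _  _  = contradiction refl ne
  common-nonneighbour (zᴮ _) _      _ _ ne _  _  = contradiction refl ne
  common-nonneighbour _      (kᴬ _) _ _ _  ne _  = contradiction refl ne
  common-nonneighbour _      (zᴮ _) _ _ _  ne _  = contradiction refl ne

  -- Outside the third part the graph is edgeless, so both edges of a `2P₂` have an end in that
  -- clique, and these ends would be adjacent.
  2P₂-free : ¬ Occurs 2P₂ (CliqueAdj {N} {r} false x y)
  2P₂-free o = meet (split-edge _ _ (edge 0F 1F refl)) (split-edge _ _ (edge 2F 3F refl))
    where
    open Occurs o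
    apart : ∀ i j → i ≢ j → adj 2P₂ i j ≡ false → part (at i) ≡ 2F → part (at j) ≡ 2F → ⊥
    apart i j i≢j eq ei ej = nonedge i j eq (third-part-clique _ _ ei ej (distinct i j i≢j))
    meet : part (at 0F) ≡ 2F ⊎ part (at 1F) ≡ 2F → part (at 2F) ≡ 2F ⊎ part (at 3F) ≡ 2F → ⊥
    meet (inj₁ e) (inj₁ f) = apart 0F 2F (λ ()) refl e f
    meet (inj₁ e) (inj₂ f) = apart 0F 3F (λ ()) refl e f
    meet (inj₂ e) (inj₁ f) = apart 1F 2F (λ ()) refl e f
    meet (inj₂ e) (inj₂ f) = apart 1F 3F (λ ()) refl e f

  nonedge⇒parts-differ : ∀ {n} {F : Graph n} (o : Occurs F (CliqueAdj {N} {r} true x y)) i j → i ≢ j →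
                         adj F i j ≡ false → part (Occurs.at o i) ≢ part (Occurs.at o j)
  nonedge⇒parts-differ o i j i≢j eq same =
    nonedge i j eq (part-clique _ _ same (distinct i j i≢j))
    where open Occurs o

  4P₁-free : ¬ Occurs 4P₁ (CliqueAdj {N} {r} true x y)
  4P₁-free o = let i , j , i<j , same = Fin.pigeonhole ℕ.≤-refl (part ∘ Occurs.at o) in
    nonedge⇒parts-differ o i j (Fin.<⇒≢ i<j) (edgeless i j) same
    where
    edgeless : ∀ i j → adj 4P₁ i j ≡ false
    edgeless = from-yes (Fin.all? λ i → Fin.all? λ j → adj 4P₁ i j Bool.≟ false)

  -- Nonadjacent vertices lie in different parts, so 0 and 1 share a part, 2 and 3 share another and
  -- 4 lies in the remaining one; as there are no edges between uᴬ's and vᴮ's, one of the two pairs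
  -- lies in the part 2F.
  P₄+P₁-free : ¬ Occurs P₄+P₁ (CliqueAdj {N} {r} true x y)
  P₄+P₁-free o = third-part-end (cross-edge _ _ (edge 1F 2F refl)
    λ e → apart 0F 2F (λ ()) refl (≡-trans c₀≡c₁ e))
    where
    open Occurs o
    apart : ∀ i j → i ≢ j → adj P₄+P₁ i j ≡ false → part (at i) ≢ part (at j)
    apart = nonedge⇒parts-differ o
    c₀≡c₁ : part (at 0F) ≡ part (at 1F)
    c₀≡c₁ = same-part _ _ _ _ (apart 0F 3F (λ ()) refl) (apart 0F 4F (λ ()) refl)
      (apart 3F 4F (λ ()) refl) (apart 1F 3F (λ ()) refl) (apart 1F 4F (λ ()) refl)
    c₂≡c₃ : part (at 2F) ≡ part (at 3F)
    c₂≡c₃ = same-part _ _ _ _ (apart 2F 0F (λ ()) refl) (apart 2F 4F (λ ()) refl)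
      (apart 0F 4F (λ ()) refl) (apart 3F 0F (λ ()) refl) (apart 3F 4F (λ ()) refl)
    third-part-end : part (at 1F) ≡ 2F ⊎ part (at 2F) ≡ 2F → ⊥
    third-part-end (inj₁ e) = distinct 0F 1F (λ ()) (common-nonneighbour (at 3F) (at 4F) _ _
      (λ f → apart 1F 3F (λ ()) refl (≡-trans e (sym f)))
      (λ f → apart 1F 4F (λ ()) refl (≡-trans e (sym f))) (apart 3F 4F (λ ()) refl)
      (≡-trans c₀≡c₁ e) e (nonedge 3F 0F refl) (nonedge 3F 1F refl) (nonedge 4F 0F refl) (nonedge 4F 1F refl))
    third-part-end (inj₂ e) = distinct 2F 3F (λ ()) (common-nonneighbour (at 0F) (at 4F) _ _
      (λ f → apart 2F 0F (λ ()) refl (≡-trans e (sym f)))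
      (λ f → apart 2F 4F (λ ()) refl (≡-trans e (sym f))) (apart 0F 4F (λ ()) refl)
      e (≡-trans (sym c₂≡c₃) e) (nonedge 0F 2F refl) (nonedge 0F 3F refl) (nonedge 4F 2F refl) (nonedge 4F 3F refl))

-- Trees, with or without edges between siblings

TreeA : ℕ → Set
TreeA N = Fin N ⊎ (Fin N ⊎ Fin 4)

-- The last summand holds `eᴮ` and `r` padding leaves, all children of `g₂ᴬ`.
TreeB : ℕ → ℕ → Set
TreeB N r = Fin N ⊎ (Fin N ⊎ Fin (1 + r))

TreeVertex : ℕ → ℕ → Set
TreeVertex N r = TreeA N ⊎ TreeB N r

pattern sᴬ i   = inj₁ i
pattern aᴬ i   = inj₂ (inj₁ i)
pattern ρᴬ     = inj₂ (inj₂ 0F)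
pattern g₁ᴬ    = inj₂ (inj₂ 1F)
pattern g₂ᴬ    = inj₂ (inj₂ 2F)
pattern cᴬ     = inj₂ (inj₂ 3F)
pattern bᴮ i   = inj₁ i
pattern tᴮ i   = inj₂ (inj₁ i)
pattern eᴮ     = inj₂ (inj₂ zero)
pattern padᴮ z = inj₂ (inj₂ (suc z))

_≟ᵗ_ : ∀ {N r} (p q : TreeVertex N r) → Dec (p ≡ q)
_≟ᵗ_ = ≡-dec (≡-dec Fin._≟_ (≡-dec Fin._≟_ Fin._≟_)) (≡-dec Fin._≟_ (≡-dec Fin._≟_ Fin._≟_))

parentA : ∀ {N} → Bits N → TreeA N → TreeA N
parentA x (sᴬ i) = cᴬ
parentA x (aᴬ i) = if x i then cᴬ else sᴬ i
-- The root is its own parent; the condition `p ≢ q` in `TreeAdj` removes the loop.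
parentA x ρᴬ     = ρᴬ
parentA x g₁ᴬ    = ρᴬ
parentA x g₂ᴬ    = g₁ᴬ
parentA x cᴬ     = g₂ᴬ

parentB : ∀ {N r} → Bits N → TreeB N r → TreeVertex N r
parentB y (bᴮ i)   = inj₁ (aᴬ i)
parentB y (tᴮ i)   = if y i then inj₂ (bᴮ i) else inj₂ eᴮ
parentB y eᴮ       = inj₁ g₂ᴬ
parentB y (padᴮ _) = inj₁ g₂ᴬ

parent : ∀ {N r} → Bits N → Bits N → TreeVertex N r → TreeVertex N r
parent x y (inj₁ a) = inj₁ (parentA x a)
parent x y (inj₂ b) = parentB y b

-- A rooted tree for ι = false; for ι = true also siblings are adjacent.  The vertex sᴬ i lengthens
-- the leg cᴬ – aᴬ i – bᴮ i if x i = 0 and tᴮ i lengthens it if y i = 1; only if both do, tᴮ i is at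
-- depth 7.  The path from the root ρᴬ to cᴬ has length 3, the bound for distances from cᴬ.
TreeAdj : ∀ {N r} → Bool → Bits N → Bits N → TreeVertex N r → TreeVertex N r → Set
TreeAdj ι x y p q =
  p ≢ q × (parent x y p ≡ q ⊎ parent x y q ≡ p ⊎ (T ι × parent x y p ≡ parent x y q))

depth : ∀ {N r} → Bits N → Bits N → TreeVertex N r → ℕ
depth x y (inj₁ (sᴬ i))   = 4
depth x y (inj₁ (aᴬ i))   = if x i then 4 else 5
depth x y (inj₁ ρᴬ)       = 0
depth x y (inj₁ g₁ᴬ)      = 1
depth x y (inj₁ g₂ᴬ)      = 2
depth x y (inj₁ cᴬ)       = 3
depth x y (inj₂ (bᴮ i))   = if x i then 5 else 6
depth x y (inj₂ (tᴮ i))   = if y i then (if x i then 6 else 7) else 4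
depth x y (inj₂ eᴮ)       = 3
depth x y (inj₂ (padᴮ _)) = 3

module _ {N r : ℕ} (x y : Bits N) where

  -- Justifies the closed form of `depth` and shows that parent pointers have no cycle except at the
  -- root.
  depth-parent : (p : TreeVertex N r) →
                 parent x y p ≡ p ⊎ depth x y p ≡ suc (depth x y (parent x y p))
  depth-parent (inj₁ (sᴬ i))   = inj₂ refl
  depth-parent (inj₁ (aᴬ i))   with x i
  ... | true  = inj₂ refl
  ... | false = inj₂ refl
  depth-parent (inj₁ ρᴬ)       = inj₁ refl
  depth-parent (inj₁ g₁ᴬ)      = inj₂ refl
  depth-parent (inj₁ g₂ᴬ)      = inj₂ refl
  depth-parent (inj₁ cᴬ)       = inj₂ refl
  depth-parent (inj₂ (bᴮ i))   with x i
  ... | true  = inj₂ refl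
  ... | false = inj₂ refl
  depth-parent (inj₂ (tᴮ i))   with y i
  ... | false = inj₂ refl
  ... | true with x i
  ... | true  = inj₂ refl
  ... | false = inj₂ refl
  depth-parent (inj₂ eᴮ)       = inj₂ refl
  depth-parent (inj₂ (padᴮ _)) = inj₂ refl

  depth≤7 : (p : TreeVertex N r) → depth x y p ≤ 7
  depth≤7 (inj₁ (sᴬ i))   = ℕ.≤ᵇ⇒≤ 4 7 _
  depth≤7 (inj₁ (aᴬ i))   with x i
  ... | true  = ℕ.≤ᵇ⇒≤ 4 7 _
  ... | false = ℕ.≤ᵇ⇒≤ 5 7 _
  depth≤7 (inj₁ ρᴬ)       = z≤n
  depth≤7 (inj₁ g₁ᴬ)      = ℕ.≤ᵇ⇒≤ 1 7 _
  depth≤7 (inj₁ g₂ᴬ)      = ℕ.≤ᵇ⇒≤ 2 7 _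
  depth≤7 (inj₁ cᴬ)       = ℕ.≤ᵇ⇒≤ 3 7 _
  depth≤7 (inj₂ (bᴮ i))   with x i
  ... | true  = ℕ.≤ᵇ⇒≤ 5 7 _
  ... | false = ℕ.≤ᵇ⇒≤ 6 7 _
  depth≤7 (inj₂ (tᴮ i))   with y i
  ... | false = ℕ.≤ᵇ⇒≤ 4 7 _
  ... | true with x i
  ... | true  = ℕ.≤ᵇ⇒≤ 6 7 _
  ... | false = ℕ.≤-refl
  depth≤7 (inj₂ eᴮ)       = ℕ.≤ᵇ⇒≤ 3 7 _
  depth≤7 (inj₂ (padᴮ _)) = ℕ.≤ᵇ⇒≤ 3 7 _

  depth-parent≤ : (p : TreeVertex N r) → depth x y (parent x y p) ≤ depth x y p
  depth-parent≤ p with depth-parent p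
  ... | inj₁ eq = ℕ.≤-reflexive (cong (depth x y) eq)
  ... | inj₂ eq = ℕ.≤-trans (ℕ.n≤1+n _) (ℕ.≤-reflexive (sym eq))

  depth≤suc-parent : (p : TreeVertex N r) → depth x y p ≤ suc (depth x y (parent x y p))
  depth≤suc-parent p with depth-parent p
  ... | inj₁ eq = ℕ.≤-trans (ℕ.≤-reflexive (cong (depth x y) (sym eq))) (ℕ.n≤1+n _)
  ... | inj₂ eq = ℕ.≤-reflexive eq

  -- Sibling edges descend no faster than tree edges, so depth bounds distances from the root below
  -- for both values of `ι`.
  depth-lipschitz : ∀ {ι} {p q : TreeVertex N r} → TreeAdj ι x y p q → depth x y q ≤ suc (depth x y p)
  depth-lipschitz {p = p} (_ , inj₁ refl)        = ℕ.m≤n⇒m≤1+n (depth-parent≤ p)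
  depth-lipschitz {q = q} (_ , inj₂ (inj₁ refl)) = depth≤suc-parent q
  depth-lipschitz {p = p} {q} (_ , inj₂ (inj₂ (_ , eq))) = ℕ.≤-trans (depth≤suc-parent q)
    (s≤s (ℕ.≤-trans (ℕ.≤-reflexive (cong (depth x y) (sym eq))) (depth-parent≤ p)))

  depth-walk : ∀ {ι k} {p q : TreeVertex N r} → Walk (TreeAdj ι x y) k p q →
               depth x y q ≤ k + depth x y p
  depth-walk {k = k} here = ℕ.m≤n+m _ k
  depth-walk {ι} {suc k} (step e w) = ℕ.≤-trans (depth-walk w)
    (ℕ.≤-trans (ℕ.+-monoʳ-≤ k (depth-lipschitz {ι} e)) (ℕ.≤-reflexive (ℕ.+-suc k _)))

  child-deeper : {p q : TreeVertex N r} → p ≢ q → parent x y q ≡ p → depth x y p < depth x y q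
  child-deeper {q = q} p≢q refl with depth-parent q
  ... | inj₁ eq = contradiction eq p≢q
  ... | inj₂ eq = ℕ.≤-reflexive (sym eq)

module _ {N r : ℕ} (ι : Bool) where

  TreeAdj-sym : ∀ {x y} {p q : TreeVertex N r} → TreeAdj ι x y p q → TreeAdj ι x y q p
  TreeAdj-sym (p≢q , inj₁ e)               = p≢q ∘ sym , inj₂ (inj₁ e)
  TreeAdj-sym (p≢q , inj₂ (inj₁ e))        = p≢q ∘ sym , inj₁ e
  TreeAdj-sym (p≢q , inj₂ (inj₂ (t , e)))  = p≢q ∘ sym , inj₂ (inj₂ (t , sym e))

  -- Only the parent of `tᴮ i` depends on `y`, and it belongs to Bob in either case.
  parentB-local : ∀ y y′ (b : TreeB N r) {a} → parentB y b ≡ inj₁ a → parentB y′ b ≡ inj₁ a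
  parentB-local y y′ (bᴮ i)   e = e
  parentB-local y y′ (tᴮ i)   e with y i
  parentB-local y y′ (tᴮ i)   () | true
  parentB-local y y′ (tᴮ i)   () | false
  parentB-local y y′ eᴮ       e = e
  parentB-local y y′ (padᴮ _) e = e

  -- A common parent of vertices of both players is g₂, and its children are fixed.
  parentA-local : ∀ x x′ y (b : TreeB N r) a → parentB y b ≡ inj₁ (parentA x a) →
                  parentB y b ≡ inj₁ (parentA x′ a)
  parentA-local x x′ y b        (sᴬ i) e = e
  parentA-local x x′ y b        ρᴬ     e = e
  parentA-local x x′ y b        g₁ᴬ    e = e
  parentA-local x x′ y b        g₂ᴬ    e = e
  parentA-local x x′ y b        cᴬ     e = e
  parentA-local x x′ y (bᴮ j)   (aᴬ i) e with x i
  parentA-local x x′ y (bᴮ j)   (aᴬ i) () | true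
  parentA-local x x′ y (bᴮ j)   (aᴬ i) () | false
  parentA-local x x′ y (tᴮ j)   (aᴬ i) e with y j
  parentA-local x x′ y (tᴮ j)   (aᴬ i) () | true
  parentA-local x x′ y (tᴮ j)   (aᴬ i) () | false
  parentA-local x x′ y eᴮ       (aᴬ i) e with x i
  parentA-local x x′ y eᴮ       (aᴬ i) () | true
  parentA-local x x′ y eᴮ       (aᴬ i) () | false
  parentA-local x x′ y (padᴮ _) (aᴬ i) e with x i
  parentA-local x x′ y (padᴮ _) (aᴬ i) () | true
  parentA-local x x′ y (padᴮ _) (aᴬ i) () | false

  tree-localˡ : ∀ {x y y′ a} {q : TreeVertex N r} → TreeAdj ι x y (inj₁ a) q → TreeAdj ι x y′ (inj₁ a) q
  tree-localˡ {q = inj₁ _} (ne , e) = ne , e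
  tree-localˡ {x} {y} {y′} {q = inj₂ b} (ne , inj₂ (inj₁ e)) =
    ne , inj₂ (inj₁ (parentB-local y y′ b e))
  tree-localˡ {x} {y} {y′} {q = inj₂ b} (ne , inj₂ (inj₂ (t , e))) =
    ne , inj₂ (inj₂ (t , sym (parentB-local y y′ b (sym e))))

  tree-localʳ : ∀ {x x′ y b} {q : TreeVertex N r} → TreeAdj ι x y (inj₂ b) q → TreeAdj ι x′ y (inj₂ b) q
  tree-localʳ {q = inj₂ _} (ne , e) = ne , e
  tree-localʳ {q = inj₁ a} (ne , inj₁ e) = ne , inj₁ e
  tree-localʳ {x} {x′} {y} {b} {inj₁ a} (ne , inj₂ (inj₂ (t , e))) =
    ne , inj₂ (inj₂ (t , parentA-local x x′ y b a e))

  up : ∀ {x y k} {p q : TreeVertex N r} → p ≢ parent x y p →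
       Walk (TreeAdj ι x y) k (parent x y p) q → Walk (TreeAdj ι x y) (suc k) p q
  up ne = step (ne , inj₁ refl)

  a-to-c : ∀ x y i → Walk (TreeAdj {N} {r} ι x y) (if x i then 1 else 2) (inj₁ (aᴬ i)) (inj₁ cᴬ)
  a-to-c x y i with x i in eq
  ... | true  = step ((λ ()) , inj₁ (cong (λ β → inj₁ (if β then cᴬ else sᴬ i)) eq)) here
  ... | false = step ((λ ()) , inj₁ (cong (λ β → inj₁ (if β then cᴬ else sᴬ i)) eq)) (up (λ ()) here)

  b-to-c : ∀ x y i → Walk (TreeAdj {N} {r} ι x y) (if x i then 2 else 3) (inj₂ (bᴮ i)) (inj₁ cᴬ)
  b-to-c x y i with x i | a-to-c x y i
  ... | true  | w = up (λ ()) w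
  ... | false | w = up (λ ()) w

  e-to-c : ∀ {x y} → Walk (TreeAdj {N} {r} ι x y) 2 (inj₂ eᴮ) (inj₁ cᴬ)
  e-to-c = up (λ ()) (step ((λ ()) , inj₂ (inj₁ refl)) here)

  -- With equal inputs `tᴮ i` hangs from `bᴮ i` only when the leg is short, and otherwise from `eᴮ`;
  -- either way it is within 3 of the centre `cᴬ`, whence `D = 6`.
  to-c : ∀ x (p : TreeVertex N r) → Walk (TreeAdj ι x x) 3 p (inj₁ cᴬ)
  to-c x (inj₁ (sᴬ i))   = up (λ ()) here
  to-c x (inj₁ (aᴬ i))   with x i | a-to-c x x i
  ... | true  | w = Walk-mono (ℕ.≤ᵇ⇒≤ 1 3 _) w
  ... | false | w = Walk-mono (ℕ.≤ᵇ⇒≤ 2 3 _) w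
  to-c x (inj₁ ρᴬ)       = Walk-sym TreeAdj-sym (up (λ ()) (up (λ ()) (up (λ ()) (here {k = 0}))))
  to-c x (inj₁ g₁ᴬ)      = Walk-sym TreeAdj-sym (up (λ ()) (up (λ ()) (here {k = 1})))
  to-c x (inj₁ g₂ᴬ)      = Walk-sym TreeAdj-sym (up (λ ()) (here {k = 2}))
  to-c x (inj₁ cᴬ)       = here
  to-c x (inj₂ (bᴮ i))   with x i | b-to-c x x i
  ... | true  | w = Walk-mono (ℕ.≤ᵇ⇒≤ 2 3 _) w
  ... | false | w = w
  to-c x (inj₂ (tᴮ i))   with x i in eq | b-to-c x x i
  ... | true  | w = step ((λ ()) , inj₁ (cong (λ β → if β then inj₂ (bᴮ i) else inj₂ eᴮ) eq)) w
  ... | false | _ = step ((λ ()) , inj₁ (cong (λ β → if β then inj₂ (bᴮ i) else inj₂ eᴮ) eq)) e-to-c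
  to-c x (inj₂ eᴮ)       = Walk-mono (ℕ.≤ᵇ⇒≤ 2 3 _) e-to-c
  to-c x (inj₂ (padᴮ _)) = up (λ ()) (step ((λ ()) , inj₂ (inj₁ refl)) here)

  tree-far : ∀ {x y} i → x i ≡ false → y i ≡ true → ∃₂ λ p q → ¬ Walk (TreeAdj {N} {r} ι x y) 6 p q
  tree-far {x} {y} i xi yi = inj₁ ρᴬ , inj₂ (tᴮ i) , λ w → ℕ.<-irrefl deep (s≤s (depth-walk x y w))
    where
    deep : depth {N} {r} x y (inj₂ (tᴮ i)) ≡ 7
    deep rewrite yi | xi = refl

  treeFamily : Family N 6 (TreeA N) (TreeB N r)
  treeFamily = record
    { Adj     = TreeAdj ι
    ; Adj?    = λ x y p q → ¬? (p ≟ᵗ q) ×-dec (parent x y p ≟ᵗ q ⊎-dec (parent x y q ≟ᵗ p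
                  ⊎-dec (T? ι ×-dec parent x y p ≟ᵗ parent x y q)))
    ; Adj-sym = TreeAdj-sym
    ; Adj-irr = λ (p≢p , _) → p≢p refl
    ; localˡ  = tree-localˡ
    ; localʳ  = tree-localʳ
    ; close   = λ x p q → Walk-++ (to-c x p) (Walk-sym TreeAdj-sym (to-c x q))
    ; far     = tree-far
    }

-- Excluded subgraphs of the trees

module _ {N r : ℕ} {x y : Bits N} where

  -- Of two neighbours at most one is the parent, so every vertex of an occurrence of F has
  -- a deeper neighbour in it.
  no-branching : ∀ {n} (F : Graph (suc n)) →
    (∀ i → ∃₂ λ j k → j ≢ k × adj F i j ≡ true × adj F i k ≡ true) →
    ¬ Occurs F (TreeAdj {N} {r} false x y)
  no-branching F branch o = climb 8 zero (ℕ.m≤m+n 8 _)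
    where
    open Occurs o
    deeper : ∀ i → ∃ λ j → depth x y (at i) < depth x y (at j)
    deeper i with j , k , j≢k , ij , ik ← branch i with edge i j ij | edge i k ik
    ... | ne , inj₂ (inj₁ e) | _                  = j , child-deeper x y ne e
    ... | _                  | ne , inj₂ (inj₁ e) = k , child-deeper x y ne e
    ... | _ , inj₁ e         | _ , inj₁ e′        =
      contradiction (≡-trans (sym e) e′) (distinct j k j≢k)
    -- With `m` moves left, each one level deeper, depth 8 would be reached, beyond the maximum 7.
    climb : ∀ m i → 8 ≤ m + depth x y (at i) → ⊥
    climb zero    i h = ℕ.<-irrefl refl (ℕ.≤-trans h (depth≤7 x y (at i)))
    climb (suc m) i h = let j , lt = deeper i in
      climb m j (ℕ.≤-trans h (ℕ.≤-trans (ℕ.≤-reflexive (sym (ℕ.+-suc m _))) (ℕ.+-monoʳ-≤ m lt)))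

  C₃-free : ¬ Occurs C₃ (TreeAdj {N} {r} false x y)
  C₃-free = no-branching C₃ λ where
    0F → 1F , 2F , (λ ()) , refl , refl
    1F → 0F , 2F , (λ ()) , refl , refl
    2F → 0F , 1F , (λ ()) , refl , refl

  C₄-free : ¬ Occurs C₄ (TreeAdj {N} {r} false x y)
  C₄-free = no-branching C₄ λ where
    0F → 1F , 3F , (λ ()) , refl , refl
    1F → 0F , 2F , (λ ()) , refl , refl
    2F → 1F , 3F , (λ ()) , refl , refl
    3F → 0F , 2F , (λ ()) , refl , refl

  C₅-free : ¬ Occurs C₅ (TreeAdj {N} {r} false x y)
  C₅-free = no-branching C₅ λ where
    0F → 1F , 4F , (λ ()) , refl , refl
    1F → 0F , 2F , (λ ()) , refl , refl
    2F → 1F , 3F , (λ ()) , refl , refl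
    3F → 2F , 4F , (λ ()) , refl , refl
    4F → 0F , 3F , (λ ()) , refl , refl

  -- A vertex together with its siblings and parent, and likewise its set of children, is a
  -- clique, so a neighbourhood has no three pairwise nonadjacent vertices.
  claw-free : ¬ Occurs claw (TreeAdj {N} {r} true x y)
  claw-free o = two-alike (side 0F refl) (side 1F refl) (side 2F refl)
    where
    open Occurs o
    Above Below : Fin 3 → Set
    Above j = parent x y (at 0F) ≡ at (suc j) ⊎ parent x y (at 0F) ≡ parent x y (at (suc j))
    Below j = parent x y (at (suc j)) ≡ at 0F
    side : ∀ j → adj claw 0F (suc j) ≡ true → Above j ⊎ Below j
    side j e with edge 0F (suc j) e
    ... | _ , inj₁ p              = inj₁ (inj₁ p)
    ... | _ , inj₂ (inj₁ p)       = inj₂ p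
    ... | _ , inj₂ (inj₂ (_ , p)) = inj₁ (inj₂ p)
    join-leaves : ∀ i j → i ≢ j → (at (suc i) ≢ at (suc j) → TreeAdj true x y (at (suc i)) (at (suc j))) → ⊥
    join-leaves i j i≢j a = nonedge (suc i) (suc j) refl (a (distinct _ _ (i≢j ∘ Fin.suc-injective)))
    above : ∀ i j → i ≢ j → Above i → Above j → ⊥
    above i j i≢j p q = join-leaves i j i≢j λ ne → adjacent ne p q
      where
      adjacent : at (suc i) ≢ at (suc j) → Above i → Above j → TreeAdj true x y (at (suc i)) (at (suc j))
      adjacent ne (inj₁ e) (inj₁ f) = contradiction (≡-trans (sym e) f) ne
      adjacent ne (inj₁ e) (inj₂ f) = ne , inj₂ (inj₁ (≡-trans (sym f) e))
      adjacent ne (inj₂ e) (inj₁ f) = ne , inj₁ (≡-trans (sym e) f)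
      adjacent ne (inj₂ e) (inj₂ f) = ne , inj₂ (inj₂ (_ , ≡-trans (sym e) f))
    below : ∀ i j → i ≢ j → Below i → Below j → ⊥
    below i j i≢j e f = join-leaves i j i≢j λ ne → ne , inj₂ (inj₂ (_ , ≡-trans e (sym f)))
    two-alike : Above 0F ⊎ Below 0F → Above 1F ⊎ Below 1F → Above 2F ⊎ Below 2F → ⊥
    two-alike (inj₁ p) (inj₁ q) _        = above 0F 1F (λ ()) p q
    two-alike (inj₁ p) (inj₂ _) (inj₁ q) = above 0F 2F (λ ()) p q
    two-alike (inj₁ _) (inj₂ p) (inj₂ q) = below 1F 2F (λ ()) p q
    two-alike (inj₂ p) (inj₂ q) _        = below 0F 1F (λ ()) p q
    two-alike (inj₂ p) (inj₁ _) (inj₂ q) = below 0F 2F (λ ()) p q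
    two-alike (inj₂ _) (inj₁ p) (inj₁ q) = above 1F 2F (λ ()) p q

-- Combining the families

MemoryBound : ∀ {h} → Graph h → Set
MemoryBound H = ∃[ d ] ∃[ N ] ((n : ℕ) → N ≤ n → (p m : ℕ) → 1 ≤ p →
  (A : Alg n p m) → SolvesDiameterFree H A → n ≤ d * (p * m))

enum₃ : ∀ {a b c} → Fin (a + (b + c)) ↔ (Fin a ⊎ (Fin b ⊎ Fin c))
enum₃ {a} = (↔-id (Fin a) ⊎-↔ Fin.+↔⊎) ↔-∘ Fin.+↔⊎

-- Graphs without an induced `F` are also `H`-free, so the algorithm must be correct on the whole
-- family.
family-bound : ∀ {N D α β A B} (𝓕 : Family N D A B) (enumA : Fin α ↔ A) (enumB : Fin β ↔ B) →
  ∀ {h f} {H : Graph h} {F : Graph f} → InducedSub F H →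
  (∀ x y → ¬ Occurs F (Family.Adj 𝓕 x y)) →
  ∀ {p m} (𝓐 : Alg (α + β) p m) → SolvesDiameterFree H 𝓐 → N ≤ (m + m) * p
family-bound 𝓕 enumA enumB {H = H} {F} F⊑H absent 𝓐 solves =
  memory-bound 𝓕 enumA enumB 𝓐 λ x y →
    let G = graph 𝓕 enumA enumB x y in
    solves G (λ H⊑G → absent x y (InducedSub⇒Occurs 𝓕 enumA enumB {F = F}
      (InducedSub-trans {F = F} {H} {G} F⊑H H⊑G))) id

MemoryBound-sized : ∀ {h} {H : Graph h} (size : ℕ → ℕ → ℕ) →
  (∀ N r → size N r ≡ 5 + (r + N * 4)) →
  (∀ N r {p m} (𝓐 : Alg (size N r) p m) → SolvesDiameterFree H 𝓐 → N ≤ (m + m) * p) →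
  MemoryBound H
-- Division of `n ∸ 5` by 4 yields `N` and the padding `r ≤ 3`; `n ≥ 9` gives `N ≥ 1`. Then
-- `n ≤ 8 + 4N ≤ 12N`, and `N ≤ 2pm` gives the factor 24.
MemoryBound-sized {H = H} size size-eq bound = 24 , 9 , λ n 9≤n p m _ 𝓐 solves →
  sized n _ _ (n-eq n 9≤n) (ℕ.s≤s⁻¹ (m%n<n (n ∸ 5) 4)) (m≥n⇒m/n>0 (ℕ.∸-monoˡ-≤ 5 9≤n)) 𝓐 solves
  where
  open ℕ.≤-Reasoning

  n-eq : ∀ n → 9 ≤ n → n ≡ size ((n ∸ 5) / 4) ((n ∸ 5) % 4)
  n-eq n 9≤n = ≡-trans (sym (ℕ.m+[n∸m]≡n (ℕ.≤-trans (ℕ.≤ᵇ⇒≤ 5 9 _) 9≤n)))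
    (≡-trans (cong (5 +_) (m≡m%n+[m/n]*n (n ∸ 5) 4)) (sym (size-eq _ _)))

  scale : ∀ p m → 12 * ((m + m) * p) ≡ 24 * (p * m)
  scale = solve-∀

  collect : ∀ N → 8 * N + N * 4 ≡ 12 * N
  collect = solve-∀

  sized : ∀ n N r → n ≡ size N r → r ≤ 3 → 1 ≤ N → ∀ {p m} (𝓐 : Alg n p m) →
          SolvesDiameterFree H 𝓐 → n ≤ 24 * (p * m)
  sized _ N r refl r≤3 1≤N {p} {m} 𝓐 solves = begin
    size N r            ≡⟨ size-eq N r ⟩
    5 + (r + N * 4)     ≡⟨ ℕ.+-assoc 5 r (N * 4) ⟨
    5 + r + N * 4       ≤⟨ ℕ.+-monoˡ-≤ (N * 4) (ℕ.+-monoʳ-≤ 5 r≤3) ⟩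
    8 * 1 + N * 4       ≤⟨ ℕ.+-monoˡ-≤ (N * 4) (ℕ.*-monoʳ-≤ 8 1≤N) ⟩
    8 * N + N * 4       ≡⟨ collect N ⟩
    12 * N              ≤⟨ ℕ.*-monoʳ-≤ 12 (bound N r 𝓐 solves) ⟩
    12 * ((m + m) * p)  ≡⟨ scale p m ⟩
    24 * (p * m)        ∎

tree-bound : ∀ {h f} {H : Graph h} {F : Graph f} ι →
  (∀ {N r} {x y : Bits N} → ¬ Occurs F (TreeAdj {N} {r} ι x y)) → InducedSub F H → MemoryBound H
tree-bound {H = H} {F} ι absent F⊑H = MemoryBound-sized {H = H} _ size-eq λ N r →
  family-bound (treeFamily {N} {r} ι) enum₃ enum₃ {H = H} {F} F⊑H (λ _ _ → absent)
  where
  size-eq : ∀ N r → (N + (N + 4)) + (N + (N + (1 + r))) ≡ 5 + (r + N * 4)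
  size-eq = solve-∀

clique-bound : ∀ {h f} {H : Graph h} {F : Graph f} ι →
  (∀ {N r} {x y : Bits N} → ¬ Occurs F (CliqueAdj {N} {r} ι x y)) → InducedSub F H → MemoryBound H
clique-bound {H = H} {F} ι absent F⊑H = MemoryBound-sized {H = H} _ size-eq λ N r →
  -- The extra padding `3 + N` gives the clique graphs the same order as the trees.
  family-bound (cliqueFamily {N} {3 + (N + r)} ι) Fin.+↔⊎ Fin.+↔⊎ {H = H} {F} F⊑H (λ _ _ → absent)
  where
  size-eq : ∀ N r → (N + N) + (N + (2 + (3 + (N + r)))) ≡ 5 + (r + N * 4)
  size-eq = solve-∀

obstructed-bound : ∀ {h} {H : Graph h} → Obstructed H → MemoryBound H
obstructed-bound {H = H} = All.lookupWith {R = λ _ → MemoryBound H} (λ bound F⊑H → bound F⊑H) bounds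
  where
  bounds : All (λ F → InducedSub (proj₂ F) H → MemoryBound H) obstructions
  bounds = tree-bound {H = H} false C₃-free ∷ tree-bound {H = H} false C₄-free
    ∷ tree-bound {H = H} false C₅-free ∷ tree-bound {H = H} true claw-free
    ∷ clique-bound {H = H} false 2P₂-free ∷ clique-bound {H = H} true 4P₁-free
    ∷ clique-bound {H = H} true P₄+P₁-free ∷ []

theorem2 : (k : ℕ) (H : Graph k) →
    ¬ InducedSub H (P 4) → ¬ Iso H 3P₁ → ¬ Iso H P₃+P₁ → ¬ Iso H P₂+2P₁ →
    ∃[ d ] ∃[ N ] ((n : ℕ) → N ≤ n → (p m : ℕ) → 1 ≤ p →
    (A : Alg n p m) → SolvesDiameterFree H A → n ≤ d * (p * m))
theorem2 _ H ¬P₄ ¬3P₁ ¬P₃+P₁ ¬P₂+2P₁ with classify _ H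
... | inj₁ obs                    = obstructed-bound {H = H} obs
... | inj₂ (inj₁ e)               = contradiction e ¬P₄
... | inj₂ (inj₂ (inj₁ e))        = contradiction e ¬3P₁
... | inj₂ (inj₂ (inj₂ (inj₁ e))) = contradiction e ¬P₃+P₁
... | inj₂ (inj₂ (inj₂ (inj₂ e))) = contradiction e ¬P₂+2P₁
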